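{- $\{\omega^2, (\omega^2)^\star\} \leq_c \{\omega^3, (\omega^3)^\star\}$.
   Context: Structures have domains contained in $\omega$. For countable structures $\mathcal{A},\mathcal{B}$, the class $\{\mathcal{A},\mathcal{B}\}$ denotes the class of all structures (with domain $\subseteq\omega$) isomorphic to $\mathcal{A}$ or to $\mathcal{B}$. Linear orders are in the language $\{<\}$; $L^\star$ is the reverse of a linear order $L$; $\omega^2$, $\omega^3$ are ordinal order types. An enumeration operator $\Gamma$ is a c.e. set of pairs $(\alpha,\varphi)$ with $\alpha$ a finite set of basic (atomic or negated atomic) sentences of the input language with constants from $\omega$ and $\varphi$ a basic sentence of the output language with constants from $\omega$; $\Gamma(X)=\{\varphi : (\alpha,\varphi)\in\Gamma,\ \alpha\subseteq X\}$. $\Gamma$ is a computable embedding of $\mathcal{K}_0$ into $\mathcal{K}_1$ ($\mathcal{K}_0\leq_c\mathcal{K}_1$) if for every $\mathcal{A}\in\mathcal{K}_0$, $\Gamma$ applied to the atomic diagram of $\mathcal{A}$ is the atomic diagram of a structure $\Gamma(\mathcal{A})\in\mathcal{K}_1$, and for all $\mathcal{A},\mathcal{B}\in\mathcal{K}_0$, $\mathcal{A}\cong\mathcal{B}$ iff $\Gamma(\mathcal{A})\cong\Gamma(\mathcal{B})$. -}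

module Defs where

open import Level using (0ℓ) renaming (suc to lsuc)
open import Data.Fin.Base using (Fin)
open import Data.List.Base using (List; []; _∷_)
open import Data.List.Relation.Unary.All using (All)
open import Data.Nat.Base as ℕ using (ℕ; zero; suc; _+_)
open import Data.Nat.Properties using (<-strictTotalOrder)
open import Data.Product.Base using (Σ; ∃; _×_; _,_; proj₁; proj₂)
open import Data.Product.Relation.Binary.Lex.Strict using (×-strictTotalOrder)
open import Data.Sum.Base using (_⊎_)
open import Data.Vec.Base using (Vec; []; _∷_; lookup)
open import Function.Base using (_on_)
open import Function.Bundles using (_⇔_)
open import Relation.Binary.Bundles using (StrictTotalOrder)
open import Relation.Binary.Bundles.Raw using (RawRelation)
open import Relation.Binary.Core using (Rel)
import Relation.Binary.Construct.Flip.EqAndOrd as Flip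
open import Relation.Binary.Morphism.Structures using (IsOrderIsomorphism)
open import Relation.Binary.PropositionalEquality.Core using (_≡_)
open import Relation.Nullary.Negation.Core using (¬_)
open import Relation.Unary using (Pred; _∈_; _≐_)

------------------------------------------------------------------------
-- Partial recursive functions

data Rec : ℕ → Set where
  zeroᵣ : Rec 0
  sucᵣ  : Rec 1
  projᵣ : ∀ {n} → Fin n → Rec n
  compᵣ : ∀ {m n} → Rec m → Vec (Rec n) m → Rec n
  precᵣ : ∀ {n} → Rec n → Rec (suc (suc n)) → Rec (suc n)
  muᵣ   : ∀ {n} → Rec (suc n) → Rec n

infix 4 _[_]⇓_ _[_]⇓*_

-- f [ xs ]⇓ y : the computation of f on xs halts with value y.
mutual
  data _[_]⇓_ : ∀ {n} → Rec n → Vec ℕ n → ℕ → Set where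
    zero⇓  : zeroᵣ [ [] ]⇓ 0
    suc⇓   : ∀ {x} → sucᵣ [ x ∷ [] ]⇓ suc x
    proj⇓  : ∀ {n} {i : Fin n} {xs} → projᵣ i [ xs ]⇓ lookup xs i
    comp⇓  : ∀ {m n} {f : Rec m} {gs : Vec (Rec n) m} {xs ys z} →
             gs [ xs ]⇓* ys → f [ ys ]⇓ z → compᵣ f gs [ xs ]⇓ z
    prec0⇓ : ∀ {n} {f : Rec n} {g xs y} →
             f [ xs ]⇓ y → precᵣ f g [ 0 ∷ xs ]⇓ y
    precS⇓ : ∀ {n} {f : Rec n} {g k xs y z} →
             precᵣ f g [ k ∷ xs ]⇓ y → g [ k ∷ y ∷ xs ]⇓ z →
             precᵣ f g [ suc k ∷ xs ]⇓ z
    mu⇓    : ∀ {n} {f : Rec (suc n)} {xs k} →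
             (∀ i → i ℕ.< k → ∃ λ y → f [ i ∷ xs ]⇓ suc y) →
             f [ k ∷ xs ]⇓ 0 → muᵣ f [ xs ]⇓ k

  data _[_]⇓*_ {n} : ∀ {m} → Vec (Rec n) m → Vec ℕ n → Vec ℕ m → Set where
    []  : ∀ {xs} → [] [ xs ]⇓* []
    _∷_ : ∀ {m} {f : Rec n} {fs : Vec (Rec n) m} {xs y ys} →
          f [ xs ]⇓ y → fs [ xs ]⇓* ys → (f ∷ fs) [ xs ]⇓* (y ∷ ys)

------------------------------------------------------------------------
-- Basic sentences in the language {<} with equality and constants from ω

infix 6 _≈ᶜ_ _<ᶜ_

data Atom : Set where
  _≈ᶜ_ _<ᶜ_ : ℕ → ℕ → Atom

data Basic : Set where
  pos neg : Atom → Basic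

-- Cantor's pairing function.
triangle : ℕ → ℕ
triangle zero    = 0
triangle (suc n) = suc n + triangle n

pair : ℕ → ℕ → ℕ
pair x y = triangle (x + y) + y

codeBasic : Basic → ℕ
codeBasic (pos (a ≈ᶜ b)) = pair 0 (pair a b)
codeBasic (neg (a ≈ᶜ b)) = pair 1 (pair a b)
codeBasic (pos (a <ᶜ b)) = pair 2 (pair a b)
codeBasic (neg (a <ᶜ b)) = pair 3 (pair a b)

codeList : List Basic → ℕ
codeList []      = 0
codeList (φ ∷ α) = suc (pair (codeBasic φ) (codeList α))

------------------------------------------------------------------------
-- Enumeration operators

-- A finite set of basic sentences is presented by a list of its elements;
-- order and repetitions do not affect the action of an operator.
Axioms : Set₁
Axioms = Pred (List Basic × Basic) 0ℓ

-- Computably enumerable = domain of a partial recursive function.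
CE : Axioms → Set
CE S = Σ (Rec 2) λ f → ∀ α φ →
  (α , φ) ∈ S ⇔ ∃ λ y → f [ codeList α ∷ codeBasic φ ∷ [] ]⇓ y

record EnumerationOperator : Set₁ where
  field
    axioms : Axioms
    ce     : CE axioms

  ⟦_⟧ : Pred Basic 0ℓ → Pred Basic 0ℓ
  ⟦ X ⟧ φ = ∃ λ α → (α , φ) ∈ axioms × All (_∈ X) α

------------------------------------------------------------------------
-- Structures with domain contained in ω

-- Only the restriction of _≺_ to Dom is part of the structure: isomorphisms
-- and atomic diagrams ignore its values elsewhere.
record Structure : Set₁ where
  field
    Dom : Pred ℕ 0ℓ
    _≺_ : Rel ℕ 0ℓ

  rawRelation : RawRelation 0ℓ 0ℓ 0ℓ
  rawRelation = record
    { Carrier = ∃ Dom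
    ; _≈_     = _≡_ on proj₁
    ; _∼_     = _≺_ on proj₁
    }

  _⊨_ : Pred Atom 0ℓ
  _⊨_ (a ≈ᶜ b) = a ≡ b
  _⊨_ (a <ᶜ b) = a ≺ b

  ConstantsInDom : Pred Atom 0ℓ
  ConstantsInDom (a ≈ᶜ b) = a ∈ Dom × b ∈ Dom
  ConstantsInDom (a <ᶜ b) = a ∈ Dom × b ∈ Dom

  diagram : Pred Basic 0ℓ
  diagram (pos θ) = ConstantsInDom θ × _⊨_ θ
  diagram (neg θ) = ConstantsInDom θ × ¬ (_⊨_ θ)

infix 4 _≅_

_≅_ : Rel (RawRelation 0ℓ 0ℓ 0ℓ) 0ℓ
X ≅ Y = ∃ (IsOrderIsomorphism X._≈_ Y._≈_ X._∼_ Y._∼_)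
  where module X = RawRelation X
        module Y = RawRelation Y

Class : Set₁
Class = Pred Structure 0ℓ

-- All structures with domain contained in ω that are isomorphic to X or to Y.
⟪_,_⟫ : RawRelation 0ℓ 0ℓ 0ℓ → RawRelation 0ℓ 0ℓ 0ℓ → Class
⟪ X , Y ⟫ A = (rawRelation A ≅ X) ⊎ (rawRelation A ≅ Y)
  where open Structure

------------------------------------------------------------------------
-- Computable embeddings

-- Γ maps A to B: applying Γ to the atomic diagram of A gives exactly the
-- atomic diagram of B (which determines B, as a ∈ Dom iff a ≈ᶜ a is in it).
Maps : EnumerationOperator → Structure → Structure → Set
Maps Γ A B = ⟦ A.diagram ⟧ ≐ B.diagram
  where open EnumerationOperator Γ
        module A = Structure A
        module B = Structure B

record IsComputableEmbedding (Γ : EnumerationOperator) (K₀ K₁ : Class) : Set₁ where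
  open Structure using (rawRelation)
  field
    maps : ∀ {A} → A ∈ K₀ → ∃ λ B → B ∈ K₁ × Maps Γ A B
    preservesReflects≅ :
      ∀ {A A′ B B′} → A ∈ K₀ → A′ ∈ K₀ → Maps Γ A B → Maps Γ A′ B′ →
      rawRelation A ≅ rawRelation A′ ⇔ rawRelation B ≅ rawRelation B′

infix 4 _≤c_

_≤c_ : Class → Class → Set₁
K₀ ≤c K₁ = ∃ λ Γ → IsComputableEmbedding Γ K₀ K₁

------------------------------------------------------------------------
-- Order types

LinearOrder : Set₁
LinearOrder = StrictTotalOrder 0ℓ 0ℓ 0ℓ

infixl 7 _·_
infix  8 _⋆

-- Ordinal convention: K · L is L-many copies of K, so the L-coordinate is
-- the first one compared.
_·_ : LinearOrder → LinearOrder → LinearOrder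
K · L = ×-strictTotalOrder L K

_⋆ : LinearOrder → LinearOrder
L ⋆ = Flip.strictTotalOrder L

ω ω² ω³ : LinearOrder
ω  = <-strictTotalOrder
ω² = ω · ω
ω³ = ω² · ω

⟪_,_⟫ₗ : LinearOrder → LinearOrder → Class
⟪ K , L ⟫ₗ = ⟪ StrictTotalOrder.rawRelation K , StrictTotalOrder.rawRelation L ⟫

{-# OPTIONS --safe #-}

-- For a linear order L with domain in ω and z ∈ L, let S(z) be the convex hull in L of
-- the finite set {x ∈ L : x ≤ z as numbers}, and let Γ(L) be the sum of the S(z) over
-- z ∈ L, i.e. the pairs (z , y) with y ∈ S(z), ordered lexicographically. This is a
-- positive existential definition, hence given by an enumeration operator, and it
-- commutes with reversal, so only L ≅ ω² needs attention. There each S(z) is bounded,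
-- hence shorter than ω², which embeds Γ(L) into ω³. Conversely, in every later block
-- of L all but finitely many z exceed, as numbers, the least element of L, so that S(z)
-- contains the first block; this embeds ω³ into Γ(L). Well-orders embedded in each
-- other are isomorphic.

module Submission where

open import Defs
open import Level using (0ℓ)
open import Axiom.ExcludedMiddle using (ExcludedMiddle)
open import Data.Empty using (⊥; ⊥-elim)
open import Data.Fin using (#_)
open import Data.Fin.Base using (Fin; zero; suc)
open import Data.List.Base using (List; []; _∷_)
open import Data.List.Relation.Unary.All using (All; []; _∷_)
open import Data.Nat.Base
  using (ℕ; zero; suc; pred; _+_; _*_; _∸_; _⊔_; _≤_; _<_; z≤n; s≤s)
open import Data.Nat.Induction using (<-wellFounded)
open import Data.Nat.Properties
open import Data.Product.Base using (∃; _×_; _,_; proj₁; proj₂; map₂)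
open import Data.Product.Relation.Binary.Lex.Strict using (×-wellFounded)
open import Data.Sum.Base using (_⊎_; inj₁; inj₂; [_,_]′)
open import Data.Vec.Base using (Vec; []; _∷_; lookup; tabulate)
open import Function.Base using (_∘_; flip; id; const; _on_)
open import Function.Bundles using (_⇔_; mk⇔)
open import Function.Construct.Composition using (_⇔-∘_)
open import Induction.WellFounded using (WellFounded; Acc; acc; module Subrelation)
open import Relation.Binary.Bundles using (StrictTotalOrder)
open import Relation.Binary.Bundles.Raw using (RawRelation)
import Relation.Binary.Construct.On as On
open import Relation.Binary.Core using (_Preserves_⟶_)
open import Relation.Binary.Definitions using (Transitive; tri<; tri≈; tri>)
import Relation.Binary.Morphism.Construct.Composition as Composition
import Relation.Binary.Morphism.OrderMonomorphism as OrderMonomorphism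
open import Relation.Binary.Morphism.Structures using (IsOrderIsomorphism; IsOrderMonomorphism)
open import Relation.Binary.PropositionalEquality
  using (_≡_; refl; sym; trans; cong; cong₂; subst)
open import Relation.Binary.Structures using (IsStrictTotalOrder)
open import Relation.Nullary using (¬_; yes; no)
open import Relation.Nullary.Decidable using (decidable-stable)
open import Relation.Unary using (Pred; _∈_; _≐_)
open import Relation.Unary.Properties using (≐-sym; ≐-trans)

open Structure using (rawRelation)
open StrictTotalOrder using () renaming (rawRelation to raw)

-- Partial recursive functions

mutual
  -- If two searches stopped at different points, the smaller one would be a zero in one run and a
  -- successor in the other.
  ⇓-deterministic : ∀ {n} {f : Rec n} {xs y z} → f [ xs ]⇓ y → f [ xs ]⇓ z → y ≡ z
  ⇓-deterministic zero⇓ zero⇓ = refl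
  ⇓-deterministic suc⇓ suc⇓ = refl
  ⇓-deterministic proj⇓ proj⇓ = refl
  ⇓-deterministic (comp⇓ gs f) (comp⇓ gs′ f′)
    with refl ← ⇓*-deterministic gs gs′ = ⇓-deterministic f f′
  ⇓-deterministic (prec0⇓ f) (prec0⇓ f′) = ⇓-deterministic f f′
  ⇓-deterministic (precS⇓ h g) (precS⇓ h′ g′)
    with refl ← ⇓-deterministic h h′ = ⇓-deterministic g g′
  ⇓-deterministic (mu⇓ {k = k} below at) (mu⇓ {k = k′} below′ at′) with <-cmp k k′
  ... | tri≈ _ k≡k′ _ = k≡k′
  ... | tri< k<k′ _ _ with () ← ⇓-deterministic at (proj₂ (below′ k k<k′))
  ... | tri> _ _ k′<k with () ← ⇓-deterministic (proj₂ (below k′ k′<k)) at′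

  ⇓*-deterministic : ∀ {m n} {fs : Vec (Rec n) m} {xs ys zs} →
                     fs [ xs ]⇓* ys → fs [ xs ]⇓* zs → ys ≡ zs
  ⇓*-deterministic [] [] = refl
  ⇓*-deterministic (f ∷ fs) (f′ ∷ fs′) = cong₂ _∷_ (⇓-deterministic f f′) (⇓*-deterministic fs fs′)

pattern 0F = zero
pattern 1F = suc zero
pattern 2F = suc (suc zero)

addᵣ mulᵣ monusᵣ pairᵣ : Rec 2
predᵣ triangleᵣ : Rec 1
addᵣ = precᵣ (projᵣ 0F) (compᵣ sucᵣ (projᵣ 1F ∷ []))
mulᵣ = precᵣ (compᵣ zeroᵣ []) (compᵣ addᵣ (projᵣ 2F ∷ projᵣ 1F ∷ []))
predᵣ = precᵣ zeroᵣ (projᵣ 0F)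
-- Truncated subtraction with the arguments swapped, as precᵣ recurses on the first one.
monusᵣ = precᵣ (projᵣ 0F) (compᵣ predᵣ (projᵣ 1F ∷ []))
triangleᵣ = precᵣ zeroᵣ (compᵣ addᵣ (compᵣ sucᵣ (projᵣ 0F ∷ []) ∷ projᵣ 1F ∷ []))
pairᵣ = compᵣ addᵣ (compᵣ triangleᵣ (addᵣ ∷ []) ∷ projᵣ 1F ∷ [])

addᵣ⇓ : ∀ a b → addᵣ [ a ∷ b ∷ [] ]⇓ a + b
addᵣ⇓ zero    b = prec0⇓ proj⇓
addᵣ⇓ (suc a) b = precS⇓ (addᵣ⇓ a b) (comp⇓ (proj⇓ ∷ []) suc⇓)

mulᵣ⇓ : ∀ a b → mulᵣ [ a ∷ b ∷ [] ]⇓ a * b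
mulᵣ⇓ zero    b = prec0⇓ (comp⇓ [] zero⇓)
mulᵣ⇓ (suc a) b = precS⇓ (mulᵣ⇓ a b) (comp⇓ (proj⇓ ∷ proj⇓ ∷ []) (addᵣ⇓ b (a * b)))

predᵣ⇓ : ∀ a → predᵣ [ a ∷ [] ]⇓ pred a
predᵣ⇓ zero    = prec0⇓ zero⇓
predᵣ⇓ (suc a) = precS⇓ (predᵣ⇓ a) proj⇓

monusᵣ⇓ : ∀ a b → monusᵣ [ b ∷ a ∷ [] ]⇓ a ∸ b
monusᵣ⇓ a zero    = prec0⇓ proj⇓
monusᵣ⇓ a (suc b) = subst (monusᵣ [ suc b ∷ a ∷ [] ]⇓_) (pred[m∸n]≡m∸[1+n] a b)
  (precS⇓ (monusᵣ⇓ a b) (comp⇓ (proj⇓ ∷ []) (predᵣ⇓ (a ∸ b))))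

triangleᵣ⇓ : ∀ a → triangleᵣ [ a ∷ [] ]⇓ triangle a
triangleᵣ⇓ zero    = prec0⇓ zero⇓
triangleᵣ⇓ (suc a) =
  precS⇓ (triangleᵣ⇓ a) (comp⇓ (comp⇓ (proj⇓ ∷ []) suc⇓ ∷ proj⇓ ∷ []) (addᵣ⇓ (suc a) (triangle a)))

pairᵣ⇓ : ∀ a b → pairᵣ [ a ∷ b ∷ [] ]⇓ pair a b
pairᵣ⇓ a b =
  comp⇓ (comp⇓ (addᵣ⇓ a b ∷ []) (triangleᵣ⇓ (a + b)) ∷ proj⇓ ∷ []) (addᵣ⇓ (triangle (a + b)) b)

infixr 7 _⊕_ _⊗_
_⊕_ _⊗_ : ∀ {n} → Rec n → Rec n → Rec n
f ⊕ g = compᵣ addᵣ (f ∷ g ∷ [])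
f ⊗ g = compᵣ mulᵣ (f ∷ g ∷ [])

⊕⇓ : ∀ {n} {f g : Rec n} {xs a b} → f [ xs ]⇓ a → g [ xs ]⇓ b → f ⊕ g [ xs ]⇓ a + b
⊕⇓ p q = comp⇓ (p ∷ q ∷ []) (addᵣ⇓ _ _)

⊗⇓ : ∀ {n} {f g : Rec n} {xs a b} → f [ xs ]⇓ a → g [ xs ]⇓ b → f ⊗ g [ xs ]⇓ a * b
⊗⇓ p q = comp⇓ (p ∷ q ∷ []) (mulᵣ⇓ _ _)

rename : ∀ {m n} → (Fin n → Fin m) → Vec (Rec m) n
rename ρ = tabulate (projᵣ ∘ ρ)

-- The hypothesis is pointwise so that induction on `v` can replace `ρ` by `ρ ∘ suc`.
rename⇓ : ∀ {m n} {ρ : Fin n → Fin m} {xs} v →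
          (∀ i → lookup xs (ρ i) ≡ lookup v i) → rename ρ [ xs ]⇓* v
rename⇓ []      _ = []
rename⇓ {xs = xs} (x ∷ v) p = subst (projᵣ _ [ xs ]⇓_) (p zero) proj⇓ ∷ rename⇓ v (p ∘ suc)

-- A finite product vanishes iff a factor does, so `∏` acts as a bounded existential quantifier.
∏ : (ℕ → ℕ) → ℕ → ℕ
∏ f zero    = 1
∏ f (suc k) = ∏ f k * f k

∏≡0⇒∃ : ∀ f k → ∏ f k ≡ 0 → ∃ λ i → f i ≡ 0
∏≡0⇒∃ f (suc k) eq with m*n≡0⇒m≡0∨n≡0 (∏ f k) eq
... | inj₁ p = ∏≡0⇒∃ f k p
... | inj₂ p = k , p

∏≡0 : ∀ f {i k} → i < k → f i ≡ 0 → ∏ f k ≡ 0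
∏≡0 f {i} {suc k} (s≤s i≤k) fi≡0 with m≤n⇒m<n∨m≡n i≤k
... | inj₁ i<k  = cong (_* f k) (∏≡0 f i<k fi≡0)
... | inj₂ refl = trans (cong (∏ f k *_) fi≡0) (*-zeroʳ (∏ f k))

-- While `f 0` is positive the search moves on to `f ∘ suc`, for which the known zero is one step
-- nearer. The last clause has the form that `mu⇓` asks for.
least-zero : ∀ (f : ℕ → ℕ) k → f k ≡ 0 →
             ∃ λ m → f m ≡ 0 × (∀ i → i < m → ∃ λ y → f i ≡ suc y)
least-zero f k fk≡0 with f 0 in eq
... | zero = 0 , eq , λ _ ()
least-zero f zero fk≡0 | suc y with () ← trans (sym eq) fk≡0
least-zero f (suc k) fk≡0 | suc y with m , fm≡0 , below ← least-zero (f ∘ suc) k fk≡0 =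
  suc m , fm≡0 , λ { zero _ → y , eq ; (suc i) (s≤s i<m) → below i i<m }

-- Existential formulas over (ℕ , ≤ , pairing) define c.e. sets

infix  6 _≈ᵗ_ _≤ᵗ_
infixr 5 _∧_
infixr 4 _∨_

data Term (n : ℕ) : Set where
  var   : Fin n → Term n
  zeroᵗ : Term n
  sucᵗ  : Term n → Term n
  ⟨_,_⟩ : Term n → Term n → Term n

data Formula (n : ℕ) : Set where
  _≈ᵗ_ _≤ᵗ_ : Term n → Term n → Formula n
  _∧_ _∨_   : Formula n → Formula n → Formula n
  ex        : Formula (suc n) → Formula n

-- The interpretation of ⟨_,_⟩ is a parameter: unfolding nested instances of the
-- Cantor pairing during conversion checking is exponential.
module Semantics (_∙_ : ℕ → ℕ → ℕ) where

  ⟦_⟧ᵗ : ∀ {n} → Term n → Vec ℕ n → ℕ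
  ⟦ var i ⟧ᵗ     v = lookup v i
  ⟦ zeroᵗ ⟧ᵗ     v = 0
  ⟦ sucᵗ t ⟧ᵗ    v = suc (⟦ t ⟧ᵗ v)
  ⟦ ⟨ s , t ⟩ ⟧ᵗ v = ⟦ s ⟧ᵗ v ∙ ⟦ t ⟧ᵗ v

  ⟦_⟧ᶠ : ∀ {n} → Formula n → Vec ℕ n → Set
  ⟦ s ≈ᵗ t ⟧ᶠ v = ⟦ s ⟧ᵗ v ≡ ⟦ t ⟧ᵗ v
  ⟦ s ≤ᵗ t ⟧ᶠ v = ⟦ s ⟧ᵗ v ≤ ⟦ t ⟧ᵗ v
  ⟦ φ ∧ ψ ⟧ᶠ v = ⟦ φ ⟧ᶠ v × ⟦ ψ ⟧ᶠ v
  ⟦ φ ∨ ψ ⟧ᶠ v = ⟦ φ ⟧ᶠ v ⊎ ⟦ ψ ⟧ᶠ v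
  ⟦ ex φ ⟧ᶠ  v = ∃ λ x → ⟦ φ ⟧ᶠ (x ∷ v)

-- Injectivity of the Cantor pairing

triangle-mono : ∀ {m n} → m ≤ n → triangle m ≤ triangle n
triangle-mono z≤n       = z≤n
triangle-mono (s≤s m≤n) = +-mono-≤ (s≤s m≤n) (triangle-mono m≤n)

-- As `y ≤ x + y`, the codes on one antidiagonal stay below the triangular number that starts the
-- next.
pair-< : ∀ {x y x′ y′} → x + y < x′ + y′ → pair x y < pair x′ y′
pair-< {x} {y} {x′} {y′} s<s′ = begin-strict
  triangle (x + y) + y        ≡⟨ +-comm (triangle (x + y)) y ⟩
  y + triangle (x + y)        <⟨ +-monoˡ-< (triangle (x + y)) (s≤s (m≤n+m y x)) ⟩
  triangle (suc (x + y))      ≤⟨ triangle-mono s<s′ ⟩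
  triangle (x′ + y′)          ≤⟨ m≤m+n (triangle (x′ + y′)) y′ ⟩
  triangle (x′ + y′) + y′     ∎
  where open ≤-Reasoning

-- Equal codes lie on the same antidiagonal by `pair-<`, and there the code determines `y`.
pair-injective : ∀ x y x′ y′ → pair x y ≡ pair x′ y′ → x ≡ x′ × y ≡ y′
pair-injective x y x′ y′ eq with <-cmp (x + y) (x′ + y′)
... | tri< lt _ _ = ⊥-elim (<-irrefl eq (pair-< {x} {y} {x′} {y′} lt))
... | tri> _ _ gt = ⊥-elim (<-irrefl (sym eq) (pair-< {x′} {y′} {x} {y} gt))
... | tri≈ _ s≡s′ _ = +-cancelʳ-≡ y x x′ (trans s≡s′ (cong (x′ +_) (sym y≡y′))) , y≡y′
  where
  y≡y′ : y ≡ y′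
  y≡y′ = +-cancelˡ-≡ (triangle (x + y)) y y′ (trans eq (cong (λ s → triangle s + y′) (sym s≡s′)))

-- Coding of basic sentences and the axioms of the hull operator

components : Basic → ℕ × ℕ × ℕ
components (pos (a ≈ᶜ b)) = 0 , a , b
components (neg (a ≈ᶜ b)) = 1 , a , b
components (pos (a <ᶜ b)) = 2 , a , b
components (neg (a <ᶜ b)) = 3 , a , b

-- A left inverse of `components` yields injectivity without comparing constructors pairwise. Tags
-- above 3 are junk and fall into the last clause.
fromComponents : ℕ × ℕ × ℕ → Basic
fromComponents (0 , a , b) = pos (a ≈ᶜ b)
fromComponents (1 , a , b) = neg (a ≈ᶜ b)
fromComponents (2 , a , b) = pos (a <ᶜ b)
fromComponents (_ , a , b) = neg (a <ᶜ b)

fromComponents-components : ∀ φ → fromComponents (components φ) ≡ φ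
fromComponents-components (pos (a ≈ᶜ b)) = refl
fromComponents-components (neg (a ≈ᶜ b)) = refl
fromComponents-components (pos (a <ᶜ b)) = refl
fromComponents-components (neg (a <ᶜ b)) = refl

-- That z is in L and x ≤ y ≤ w in L; if moreover x and w are numerically at most z, then
-- y is in the hull S(z).
evidence : ℕ → ℕ → ℕ → ℕ → List Basic → List Basic
evidence z y x w α = pos (z ≈ᶜ z) ∷ neg (y <ᶜ x) ∷ neg (w <ᶜ y) ∷ α

data Reflexive (u : ℕ) : Basic → Set where
  pos≈ : Reflexive u (pos (u ≈ᶜ u))
  neg< : Reflexive u (neg (u <ᶜ u))

-- The two ways for `(z , y)` to precede `(z′ , y′)` lexicographically. Equality of first
-- coordinates is equality of numbers, hence a side condition rather than a sentence read from the
-- input.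
data Premise (z y z′ y′ : ℕ) : Basic → Set where
  first  : Premise z y z′ y′ (pos (z <ᶜ z′))
  second : z ≡ z′ → Premise z y z′ y′ (pos (y <ᶜ y′))

-- All that the diagram of a linear order says in both constants once `u` lies below `v`.
data Strict (u v : ℕ) : Basic → Set where
  pos<  : Strict u v (pos (u <ᶜ v))
  neg>  : Strict u v (neg (v <ᶜ u))
  neg≈  : Strict u v (neg (u ≈ᶜ v))
  neg≈˘ : Strict u v (neg (v ≈ᶜ u))

module _ {n : ℕ} where
  posEq negEq posLt negLt : Term n → Term n → Term n
  posEq s t = ⟨ zeroᵗ , ⟨ s , t ⟩ ⟩
  negEq s t = ⟨ sucᵗ zeroᵗ , ⟨ s , t ⟩ ⟩
  posLt s t = ⟨ sucᵗ (sucᵗ zeroᵗ) , ⟨ s , t ⟩ ⟩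
  negLt s t = ⟨ sucᵗ (sucᵗ (sucᵗ zeroᵗ)) , ⟨ s , t ⟩ ⟩

  infixr 7 _∷ᵗ_
  _∷ᵗ_ : Term n → Term n → Term n
  s ∷ᵗ t = sucᵗ ⟨ s , t ⟩

  evidenceᵗ : Term n → Term n → Term n → Term n → Term n → Term n
  evidenceᵗ z y x w t = posEq z z ∷ᵗ negLt y x ∷ᵗ negLt w y ∷ᵗ t

-- Arithmetized forms of the constructors `self` and `less` of `Axiom`; the two free variables are
-- the codes of the premises and of the conclusion.
selfᶠ lessᶠ axiomᶠ : Formula 2
selfᶠ = ex (ex (ex (ex (
    x ≤ᵗ z ∧ w ≤ᵗ z
  ∧ (φ ≈ᵗ posEq u u ∨ φ ≈ᵗ negLt u u)
  ∧ α ≈ᵗ evidenceᵗ z y x w zeroᵗ))))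
  where
  α φ z y x w u : Term 6
  α = var (# 4)
  φ = var (# 5)
  z = var (# 3)
  y = var (# 2)
  x = var (# 1)
  w = var (# 0)
  u = ⟨ z , y ⟩
lessᶠ = ex (ex (ex (ex (ex (ex (ex (ex (
    x ≤ᵗ z ∧ w ≤ᵗ z ∧ x′ ≤ᵗ z′ ∧ w′ ≤ᵗ z′
  ∧ (φ ≈ᵗ posLt u v ∨ φ ≈ᵗ negLt v u ∨ φ ≈ᵗ negEq u v ∨ φ ≈ᵗ negEq v u)
  ∧ (α ≈ᵗ posLt z z′ ∷ᵗ e ∨ z ≈ᵗ z′ ∧ α ≈ᵗ posLt y y′ ∷ᵗ e)))))))))
  where
  α φ z y x w z′ y′ x′ w′ u v e : Term 10
  α  = var (# 8)
  φ  = var (# 9)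
  z  = var (# 7)
  y  = var (# 6)
  x  = var (# 5)
  w  = var (# 4)
  z′ = var (# 3)
  y′ = var (# 2)
  x′ = var (# 1)
  w′ = var (# 0)
  u  = ⟨ z , y ⟩
  v  = ⟨ z′ , y′ ⟩
  e  = evidenceᵗ z y x w (evidenceᵗ z′ y′ x′ w′ zeroᵗ)
axiomᶠ = selfᶠ ∨ lessᶠ

module Coding (_∙_ : ℕ → ℕ → ℕ) (∙-injective : ∀ a b c d → a ∙ b ≡ c ∙ d → a ≡ c × b ≡ d) where

  open Semantics _∙_

  encode : ℕ × ℕ × ℕ → ℕ
  encode (t , a , b) = t ∙ (a ∙ b)

  encode-injective : ∀ {c d} → encode c ≡ encode d → c ≡ d
  encode-injective {t , a , b} {t′ , a′ , b′} eq
    with refl , eq′ ← ∙-injective t (a ∙ b) t′ (a′ ∙ b′) eq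
    with refl , refl ← ∙-injective a b a′ b′ eq′ = refl

  ⌜_⌝ : Basic → ℕ
  ⌜ φ ⌝ = encode (components φ)

  ⌜⌝-injective : ∀ {φ ψ} → ⌜ φ ⌝ ≡ ⌜ ψ ⌝ → φ ≡ ψ
  ⌜⌝-injective {φ} {ψ} eq =
    trans (sym (fromComponents-components φ))
      (trans (cong fromComponents (encode-injective eq)) (fromComponents-components ψ))

  ⌜_⌝* : List Basic → ℕ
  ⌜ [] ⌝*    = 0
  ⌜ φ ∷ α ⌝* = suc (⌜ φ ⌝ ∙ ⌜ α ⌝*)

  ⌜⌝*-injective : ∀ α β → ⌜ α ⌝* ≡ ⌜ β ⌝* → α ≡ β
  ⌜⌝*-injective []      []      _  = refl
  ⌜⌝*-injective (φ ∷ α) (ψ ∷ β) eq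
    with p , q ← ∙-injective ⌜ φ ⌝ ⌜ α ⌝* ⌜ ψ ⌝ ⌜ β ⌝* (suc-injective eq) =
    cong₂ _∷_ (⌜⌝-injective p) (⌜⌝*-injective α β q)

  -- A record, so that conversion checking never unfolds the semantics of ψ.
  record _DefinedBy_ (X : Axioms) (ψ : Formula 2) : Set where
    field
      defines : ∀ α φ → X (α , φ) ⇔ ⟦ ψ ⟧ᶠ (⌜ α ⌝* ∷ ⌜ φ ⌝ ∷ [])

  -- `less` carries evidence for both of its elements, since a sentence may enter the output diagram
  -- only if its constants lie in the output domain.
  data Axiom : List Basic → Basic → Set where
    self : ∀ {z y x w φ} → x ≤ z → w ≤ z →
           Reflexive (z ∙ y) φ → Axiom (evidence z y x w []) φ
    less : ∀ {z y x w z′ y′ x′ w′ ψ φ} → x ≤ z → w ≤ z → x′ ≤ z′ → w′ ≤ z′ →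
           Premise z y z′ y′ ψ → Strict (z ∙ y) (z′ ∙ y′) φ →
           Axiom (ψ ∷ evidence z y x w (evidence z′ y′ x′ w′ [])) φ

  hullAxioms : Axioms
  hullAxioms (α , φ) = Axiom α φ

  hullAxioms-definedBy : hullAxioms DefinedBy axiomᶠ
  hullAxioms-definedBy = record { defines = λ α φ → mk⇔ (to α φ) (from α φ) }
    where
    to : ∀ α φ → Axiom α φ → ⟦ axiomᶠ ⟧ᶠ (⌜ α ⌝* ∷ ⌜ φ ⌝ ∷ [])
    to _ _ (self {z} {y} {x} {w} x≤z w≤z r) = inj₁ (z , y , x , w , x≤z , w≤z , reflexive r , refl)
      where
      reflexive : ∀ {u φ} → Reflexive u φ →
                  ⌜ φ ⌝ ≡ ⌜ pos (u ≈ᶜ u) ⌝ ⊎ ⌜ φ ⌝ ≡ ⌜ neg (u <ᶜ u) ⌝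
      reflexive pos≈ = inj₁ refl
      reflexive neg< = inj₂ refl
    to _ _ (less {z} {y} {x} {w} {z′} {y′} {x′} {w′} x≤z w≤z x′≤z′ w′≤z′ p s) =
      inj₂ (z , y , x , w , z′ , y′ , x′ , w′ , x≤z , w≤z , x′≤z′ , w′≤z′ , strict s ,
          premise {β = evidence z y x w (evidence z′ y′ x′ w′ [])} p)
      where
      strict : ∀ {u v φ} → Strict u v φ →
               ⌜ φ ⌝ ≡ ⌜ pos (u <ᶜ v) ⌝ ⊎ ⌜ φ ⌝ ≡ ⌜ neg (v <ᶜ u) ⌝ ⊎
               ⌜ φ ⌝ ≡ ⌜ neg (u ≈ᶜ v) ⌝ ⊎ ⌜ φ ⌝ ≡ ⌜ neg (v ≈ᶜ u) ⌝
      strict pos<  = inj₁ refl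
      strict neg>  = inj₂ (inj₁ refl)
      strict neg≈  = inj₂ (inj₂ (inj₁ refl))
      strict neg≈˘ = inj₂ (inj₂ (inj₂ refl))
      premise : ∀ {β z y z′ y′ ψ} → Premise z y z′ y′ ψ →
                ⌜ ψ ∷ β ⌝* ≡ ⌜ pos (z <ᶜ z′) ∷ β ⌝* ⊎
                (z ≡ z′ × ⌜ ψ ∷ β ⌝* ≡ ⌜ pos (y <ᶜ y′) ∷ β ⌝*)
      premise first         = inj₁ refl
      premise (second z≡z′) = inj₂ (z≡z′ , refl)
    from : ∀ α φ → ⟦ axiomᶠ ⟧ᶠ (⌜ α ⌝* ∷ ⌜ φ ⌝ ∷ []) → Axiom α φ
    from α φ (inj₁ (z , y , x , w , x≤z , w≤z , cφ , cα))
      with refl ← ⌜⌝*-injective α (evidence z y x w []) cα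
      = self x≤z w≤z ([ (λ e → subst (Reflexive _) (sym (⌜⌝-injective e)) pos≈)
                      , (λ e → subst (Reflexive _) (sym (⌜⌝-injective e)) neg<) ]′ cφ)
    from α φ (inj₂ (z , y , x , w , z′ , y′ , x′ , w′ , x≤z , w≤z , x′≤z′ , w′≤z′ , cφ , cα)) = premise cα
      where
      β : List Basic
      β = evidence z y x w (evidence z′ y′ x′ w′ [])
      strict : Strict (z ∙ y) (z′ ∙ y′) φ
      strict = [ conclude pos< , [ conclude neg> , [ conclude neg≈ , conclude neg≈˘ ]′ ]′ ]′ cφ
        where
        conclude : ∀ {ψ} → Strict (z ∙ y) (z′ ∙ y′) ψ → ⌜ φ ⌝ ≡ ⌜ ψ ⌝ →
                   Strict (z ∙ y) (z′ ∙ y′) φ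
        conclude s e = subst (Strict _ _) (sym (⌜⌝-injective e)) s
      conclude : ∀ {ψ} → Premise z y z′ y′ ψ → ⌜ α ⌝* ≡ ⌜ ψ ∷ β ⌝* → Axiom α φ
      conclude {ψ} p e with refl ← ⌜⌝*-injective α (ψ ∷ β) e =
        less x≤z w≤z x′≤z′ w′≤z′ p strict
      premise : ⌜ α ⌝* ≡ ⌜ pos (z <ᶜ z′) ∷ β ⌝* ⊎
                (z ≡ z′ × ⌜ α ⌝* ≡ ⌜ pos (y <ᶜ y′) ∷ β ⌝*) → Axiom α φ
      premise (inj₁ e)          = conclude first e
      premise (inj₂ (z≡z′ , e)) = conclude (second z≡z′) e

-- Semidecidability of existential formulas by bounded search

open Semantics pair
open Coding pair pair-injective

-- Zero iff φ holds with its quantifiers bounded by k.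
defect : ∀ {n} → Formula n → ℕ → Vec ℕ n → ℕ
defect (s ≈ᵗ t) k v = (⟦ s ⟧ᵗ v ∸ ⟦ t ⟧ᵗ v) + (⟦ t ⟧ᵗ v ∸ ⟦ s ⟧ᵗ v)
defect (s ≤ᵗ t) k v = ⟦ s ⟧ᵗ v ∸ ⟦ t ⟧ᵗ v
defect (φ ∧ ψ) k v = defect φ k v + defect ψ k v
defect (φ ∨ ψ) k v = defect φ k v * defect ψ k v
defect (ex φ)  k v = ∏ (λ x → defect φ k (x ∷ v)) k

defect-sound : ∀ {n} (φ : Formula n) {k} v → defect φ k v ≡ 0 → ⟦ φ ⟧ᶠ v
defect-sound (s ≈ᵗ t) v p =
  ≤-antisym (m∸n≡0⇒m≤n (m+n≡0⇒m≡0 (⟦ s ⟧ᵗ v ∸ ⟦ t ⟧ᵗ v) p))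
            (m∸n≡0⇒m≤n (m+n≡0⇒n≡0 (⟦ s ⟧ᵗ v ∸ ⟦ t ⟧ᵗ v) p))
defect-sound (s ≤ᵗ t) v p = m∸n≡0⇒m≤n p
defect-sound (φ ∧ ψ) {k} v p =
  defect-sound φ v (m+n≡0⇒m≡0 (defect φ k v) p) , defect-sound ψ v (m+n≡0⇒n≡0 (defect φ k v) p)
defect-sound (φ ∨ ψ) {k} v p with m*n≡0⇒m≡0∨n≡0 (defect φ k v) p
... | inj₁ q = inj₁ (defect-sound φ v q)
... | inj₂ q = inj₂ (defect-sound ψ v q)
defect-sound (ex φ) {k} v p with x , q ← ∏≡0⇒∃ (λ x → defect φ k (x ∷ v)) k p =
  x , defect-sound φ (x ∷ v) q

-- Asking for all large `k`, and not just one, lets the bounds of two subformulas be merged by a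
-- maximum.
defect-complete : ∀ {n} (φ : Formula n) v → ⟦ φ ⟧ᶠ v → ∃ λ K → ∀ {k} → K ≤ k → defect φ k v ≡ 0
defect-complete (s ≈ᵗ t) v p =
  0 , λ _ → cong₂ _+_ (m≤n⇒m∸n≡0 (≤-reflexive p)) (m≤n⇒m∸n≡0 (≤-reflexive (sym p)))
defect-complete (s ≤ᵗ t) v p = 0 , λ _ → m≤n⇒m∸n≡0 p
defect-complete (φ ∧ ψ) v (p , q) with K , f ← defect-complete φ v p | L , g ← defect-complete ψ v q =
  K ⊔ L , λ K⊔L≤k → cong₂ _+_ (f (m⊔n≤o⇒m≤o K L K⊔L≤k)) (g (m⊔n≤o⇒n≤o K L K⊔L≤k))
defect-complete (φ ∨ ψ) v (inj₁ p) with K , f ← defect-complete φ v p =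
  K , λ {k} K≤k → cong (_* defect ψ k v) (f K≤k)
defect-complete (φ ∨ ψ) v (inj₂ q) with L , g ← defect-complete ψ v q =
  L , λ {k} L≤k → trans (cong (defect φ k v *_) (g L≤k)) (*-zeroʳ (defect φ k v))
defect-complete (ex φ) v (x , p) with K , f ← defect-complete φ (x ∷ v) p =
  -- The bound must exceed the witness strictly, because the product runs over numbers below `k`.
  suc x ⊔ K , λ {k} le →
    ∏≡0 (λ x → defect φ k (x ∷ v)) (m⊔n≤o⇒m≤o (suc x) K le) (f (m⊔n≤o⇒n≤o (suc x) K le))

-- Argument 0 is reserved for the quantifier bound, hence the shift of variables.
term : ∀ {n} → Term n → Rec (suc n)
term (var i)   = projᵣ (suc i)
term zeroᵗ     = compᵣ zeroᵣ []
term (sucᵗ t)  = compᵣ sucᵣ (term t ∷ [])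
term ⟨ s , t ⟩ = compᵣ pairᵣ (term s ∷ term t ∷ [])

term⇓ : ∀ {n} (t : Term n) k v → term t [ k ∷ v ]⇓ ⟦ t ⟧ᵗ v
term⇓ (var i)   k v = proj⇓
term⇓ zeroᵗ     k v = comp⇓ [] zero⇓
term⇓ (sucᵗ t)  k v = comp⇓ (term⇓ t k v ∷ []) suc⇓
term⇓ ⟨ s , t ⟩ k v = comp⇓ (term⇓ s k v ∷ term⇓ t k v ∷ []) (pairᵣ⇓ _ _)

_⊖_ : ∀ {n} → Term n → Term n → Rec (suc n)
s ⊖ t = compᵣ monusᵣ (term t ∷ term s ∷ [])

⊖⇓ : ∀ {n} (s t : Term n) k v → s ⊖ t [ k ∷ v ]⇓ ⟦ s ⟧ᵗ v ∸ ⟦ t ⟧ᵗ v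
⊖⇓ s t k v = comp⇓ (term⇓ t k v ∷ term⇓ s k v ∷ []) (monusᵣ⇓ _ _)

mutual
  test : ∀ {n} → Formula n → Rec (suc n)
  test (s ≈ᵗ t) = (s ⊖ t) ⊕ (t ⊖ s)
  test (s ≤ᵗ t) = s ⊖ t
  test (φ ∧ ψ) = test φ ⊕ test ψ
  test (φ ∨ ψ) = test φ ⊗ test ψ
  test (ex φ)  = compᵣ (testBelow φ) (projᵣ 0F ∷ projᵣ 0F ∷ rename suc)

  -- On j ∷ k ∷ v, the product of the defects of φ at bound k over the witnesses below j.
  testBelow : ∀ {n} → Formula (suc n) → Rec (suc (suc n))
  testBelow φ =
    precᵣ (compᵣ sucᵣ (compᵣ zeroᵣ [] ∷ []))
          (projᵣ 1F ⊗ compᵣ (test φ) (projᵣ 2F ∷ projᵣ 0F ∷ rename (λ i → suc (suc (suc i)))))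

mutual
  test⇓ : ∀ {n} (φ : Formula n) k v → test φ [ k ∷ v ]⇓ defect φ k v
  test⇓ (s ≈ᵗ t) k v = ⊕⇓ (⊖⇓ s t k v) (⊖⇓ t s k v)
  test⇓ (s ≤ᵗ t) k v = ⊖⇓ s t k v
  test⇓ (φ ∧ ψ) k v = ⊕⇓ (test⇓ φ k v) (test⇓ ψ k v)
  test⇓ (φ ∨ ψ) k v = ⊗⇓ (test⇓ φ k v) (test⇓ ψ k v)
  test⇓ (ex φ)  k v = comp⇓ (proj⇓ ∷ proj⇓ ∷ rename⇓ v (λ _ → refl)) (testBelow⇓ φ k k v)

  testBelow⇓ : ∀ {n} (φ : Formula (suc n)) j k v →
               testBelow φ [ j ∷ k ∷ v ]⇓ ∏ (λ x → defect φ k (x ∷ v)) j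
  testBelow⇓ φ zero    k v = prec0⇓ (comp⇓ (comp⇓ [] zero⇓ ∷ []) suc⇓)
  testBelow⇓ φ (suc j) k v = precS⇓ (testBelow⇓ φ j k v)
    (⊗⇓ proj⇓ (comp⇓ (proj⇓ ∷ proj⇓ ∷ rename⇓ v (λ _ → refl)) (test⇓ φ k (j ∷ v))))

-- The search looks for a quantifier bound with defect zero: completeness provides one if `φ` holds,
-- and by soundness any such bound verifies `φ`.
formula-semidecidable : ∀ {n} (φ : Formula n) v → ⟦ φ ⟧ᶠ v ⇔ ∃ λ y → muᵣ (test φ) [ v ]⇓ y
formula-semidecidable φ v = mk⇔ to from
  where
  to : ⟦ φ ⟧ᶠ v → ∃ λ y → muᵣ (test φ) [ v ]⇓ y
  to p with K , f ← defect-complete φ v p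
       with m , zero-at , pos-below ← least-zero (λ k → defect φ k v) K (f ≤-refl) =
    m , mu⇓ (λ i i<m → let y , eq = pos-below i i<m in
                       y , subst (test φ [ i ∷ v ]⇓_) eq (test⇓ φ i v))
            (subst (test φ [ m ∷ v ]⇓_) zero-at (test⇓ φ m v))
  from : (∃ λ y → muᵣ (test φ) [ v ]⇓ y) → ⟦ φ ⟧ᶠ v
  from (k , mu⇓ _ at) = defect-sound φ v (⇓-deterministic (test⇓ φ k v) at)

codeBasic≡ : ∀ φ → codeBasic φ ≡ ⌜ φ ⌝
codeBasic≡ (pos (a ≈ᶜ b)) = refl
codeBasic≡ (neg (a ≈ᶜ b)) = refl
codeBasic≡ (pos (a <ᶜ b)) = refl
codeBasic≡ (neg (a <ᶜ b)) = refl

codeList≡ : ∀ α → codeList α ≡ ⌜ α ⌝*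
codeList≡ []      = refl
codeList≡ (φ ∷ α) = cong suc (cong₂ pair (codeBasic≡ φ) (codeList≡ α))

definable⇒CE : ∀ {X ψ} → X DefinedBy ψ → CE X
definable⇒CE {X} {ψ} d = muᵣ (test ψ) , λ α φ →
  subst (λ v → X (α , φ) ⇔ ∃ λ y → muᵣ (test ψ) [ v ]⇓ y)
    (cong₂ (λ a f → a ∷ f ∷ []) (sym (codeList≡ α)) (sym (codeBasic≡ φ)))
    (formula-semidecidable ψ (⌜ α ⌝* ∷ ⌜ φ ⌝ ∷ []) ⇔-∘ _DefinedBy_.defines d α φ)

hullOperator : EnumerationOperator
hullOperator = record
  { axioms = hullAxioms
  ; ce     = definable⇒CE hullAxioms-definedBy
  }

-- Isomorphisms of linear orders

module _ {K L : LinearOrder} where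
  private
    module K = StrictTotalOrder K
    module L = StrictTotalOrder L

  -- Trichotomy in `K` makes a strictly increasing map reflect both equality and order.
  increasing-surjection⇒≅ :
    (f : K.Carrier → L.Carrier) →
    f Preserves K._≈_ ⟶ L._≈_ → f Preserves K._<_ ⟶ L._<_ →
    (∀ y → ∃ λ x → f x L.≈ y) → K.rawRelation ≅ L.rawRelation
  increasing-surjection⇒≅ f cong mono onto = f , record
    { isOrderMonomorphism = record
      { isOrderHomomorphism = record { cong = cong ; mono = mono }
      ; injective = injective
      ; cancel    = cancel
      }
    ; surjective = λ y → let x , fx≈y = onto y in x , λ z≈x → L.Eq.trans (cong z≈x) fx≈y
    }
    where
    injective : ∀ {x y} → f x L.≈ f y → x K.≈ y
    injective {x} {y} fx≈fy with K.compare x y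
    ... | tri< x<y _ _ = ⊥-elim (L.irrefl fx≈fy (mono x<y))
    ... | tri≈ _ x≈y _ = x≈y
    ... | tri> _ _ y<x = ⊥-elim (L.irrefl (L.Eq.sym fx≈fy) (mono y<x))
    cancel : ∀ {x y} → f x L.< f y → x K.< y
    cancel {x} {y} fx<fy with K.compare x y
    ... | tri< x<y _ _ = x<y
    ... | tri≈ _ x≈y _ = ⊥-elim (L.irrefl (cong x≈y) fx<fy)
    ... | tri> _ _ y<x = ⊥-elim (L.asym fx<fy (mono y<x))

≅-trans : ∀ {X Y Z : RawRelation 0ℓ 0ℓ 0ℓ} → Transitive (RawRelation._≈_ Z) →
          X ≅ Y → Y ≅ Z → X ≅ Z
≅-trans ≈-trans (f , F) (g , G) = g ∘ f , Composition.isOrderIsomorphism ≈-trans F G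

module _ (X : RawRelation 0ℓ 0ℓ 0ℓ) (K : LinearOrder) where
  private
    module X = RawRelation X
    module K = StrictTotalOrder K

  -- Surjectivity carries chosen preimages, which form the inverse; its laws are checked in `K`
  -- after applying `f`.
  ≅-sym : (∀ {x} → x X.≈ x) → X ≅ K.rawRelation → K.rawRelation ≅ X
  ≅-sym ≈-refl (f , F) = g , record
    { isOrderMonomorphism = record
      { isOrderHomomorphism = record
        { cong = λ {y} {z} y≈z → F.injective (K.Eq.trans (fg≈ y) (K.Eq.trans y≈z (K.Eq.sym (fg≈ z))))
        ; mono = λ {y} {z} y<z → F.cancel
            (K.<-respˡ-≈ (K.Eq.sym (fg≈ y)) (K.<-respʳ-≈ (K.Eq.sym (fg≈ z)) y<z))
        }
      ; injective = λ {y} {z} gy≈gz → K.Eq.trans (K.Eq.sym (fg≈ y)) (K.Eq.trans (F.cong gy≈gz) (fg≈ z))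
      ; cancel    = λ {y} {z} gy<gz → K.<-respˡ-≈ (fg≈ y) (K.<-respʳ-≈ (fg≈ z) (F.mono gy<gz))
      }
    ; surjective = λ x → f x , λ {z} z≈fx → F.injective (K.Eq.trans (fg≈ z) z≈fx)
    }
    where
    module F = IsOrderIsomorphism F
    g : K.Carrier → X.Carrier
    g y = proj₁ (F.surjective y)
    fg≈ : ∀ y → f (g y) K.≈ y
    fg≈ y = proj₂ (F.surjective y) ≈-refl

-- Comparison of well-orders by matching initial segments

-- Matches K L x y iff the initial segments below x and y are isomorphic.
module _ (K L : LinearOrder) where
  private
    module K = StrictTotalOrder K
    module L = StrictTotalOrder L

  data Matches (x : K.Carrier) (y : L.Carrier) : Set where
    matches : (∀ {x′} → x′ K.< x → ∃ λ y′ → Matches x′ y′ × y′ L.< y) →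
              (∀ {y′} → y′ L.< y → ∃ λ x′ → Matches x′ y′ × x′ K.< x) →
              Matches x y

Matches-flip : ∀ {K L x y} → Matches K L x y → Matches L K y x
Matches-flip (matches forth back) = matches
  (λ y′<y → let x′ , m , x′<x = back  y′<y in x′ , Matches-flip m , x′<x)
  (λ x′<x → let y′ , m , y′<y = forth x′<x in y′ , Matches-flip m , y′<y)

module _ {K L : LinearOrder} where
  private
    module K = StrictTotalOrder K
    module L = StrictTotalOrder L

  -- If `y < y′`, some `x₁ < x` matches `y`, and `x₁` also matches some `y₂ < y`; by induction
  -- `y₂ ≈ y`, a contradiction.
  Matches-functional : ∀ {x y y′} → Matches K L x y → Matches K L x y′ → y L.≈ y′
  Matches-functional {y = y} {y′} (matches forth back) (matches forth′ back′) with L.compare y y′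
  ... | tri≈ _ y≈y′ _ = y≈y′
  ... | tri< y<y′ _ _ =
    let _ , m  , x₁<x = back′ y<y′
        _ , m₂ , y₂<y = forth x₁<x
    in ⊥-elim (L.irrefl (Matches-functional m₂ m) y₂<y)
  ... | tri> _ _ y′<y =
    let _ , m  , x₁<x  = back y′<y
        _ , m₂ , y₂<y′ = forth′ x₁<x
    in ⊥-elim (L.irrefl (Matches-functional m₂ m) y₂<y′)

  Matches-mono : ∀ {x y x′ y′} → Matches K L x y → Matches K L x′ y′ → x K.< x′ → y L.< y′
  Matches-mono m (matches forth _) x<x′ =
    let _ , m₂ , y₂<y′ = forth x<x′ in L.<-respˡ-≈ (Matches-functional m₂ m) y₂<y′

  Matches-respˡ : ∀ {x x′ y} → x K.≈ x′ → Matches K L x y → Matches K L x′ y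
  Matches-respˡ x≈x′ (matches forth back) = matches
    (λ z<x′ → forth (K.<-respʳ-≈ (K.Eq.sym x≈x′) z<x′))
    (λ z<y → let z′ , m , z′<x = back z<y in z′ , m , K.<-respʳ-≈ x≈x′ z′<x)

  Matches-respʳ : ∀ {x y y′} → y L.≈ y′ → Matches K L x y → Matches K L x y′
  Matches-respʳ y≈y′ (matches forth back) = matches
    (λ z<x → let z′ , m , z′<y = forth z<x in z′ , m , L.<-respʳ-≈ y≈y′ z′<y)
    (λ z<y′ → back (L.<-respʳ-≈ (L.Eq.sym y≈y′) z<y′))

module Classical (em : ExcludedMiddle 0ℓ) where

  least : ∀ {A : Set} {_<_ : A → A → Set} (P : Pred A 0ℓ) → ∀ {x} → Acc _<_ x → P x →
          ∃ λ y → P y × (∀ {z} → z < y → ¬ P z)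
  least {_<_ = _<_} P {x} (acc rs) px with em {P = ∃ λ z → z < x × P z}
  ... | yes (z , z<x , pz) = least P (rs z<x) pz
  ... | no ∄z = x , px , λ z<x pz → ∄z (_ , z<x , pz)

  module _ {K L : LinearOrder} where
    private
      module K = StrictTotalOrder K
      module L = StrictTotalOrder L

    -- The match of `x` is the least strict upper bound of the matches below `x`. Such a bound
    -- exists because, by the invariant in `go`, each `x′ < x` has a match at most `f x′`, which is
    -- below `f x`.
    Matches-total : WellFounded K._<_ → WellFounded L._<_ →
                    (f : K.Carrier → L.Carrier) → f Preserves K._<_ ⟶ L._<_ →
                    ∀ x → ∃ λ y → Matches K L x y
    Matches-total wfK wfL f mono x = let y , m , _ = go (wfK x) in y , m
      where
      go : ∀ {x} → Acc K._<_ x → ∃ λ y → Matches K L x y × ¬ (f x L.< y)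
      go {x} (acc rs) = y , matches above (λ {y′} → reached {y′}) , λ fx<y → minimal fx<y fx-bounds
        where
        Bounds : Pred L.Carrier 0ℓ
        Bounds y = ∀ {x′} → x′ K.< x → ∃ λ y′ → Matches K L x′ y′ × y′ L.< y
        fx-bounds : Bounds (f x)
        fx-bounds {x′} x′<x with y′ , m , fx′≮y′ ← go (rs x′<x) with L.compare (f x′) y′
        ... | tri< fx′<y′ _ _ = ⊥-elim (fx′≮y′ fx′<y′)
        ... | tri≈ _ fx′≈y′ _ = y′ , m , L.<-respˡ-≈ fx′≈y′ (mono x′<x)
        ... | tri> _ _ y′<fx′ = y′ , m , L.trans y′<fx′ (mono x′<x)
        bound : ∃ λ y → Bounds y × (∀ {z} → z L.< y → ¬ Bounds z)
        bound = least Bounds (wfL (f x)) fx-bounds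
        y : L.Carrier
        y = proj₁ bound
        above : Bounds y
        above = proj₁ (proj₂ bound)
        minimal : ∀ {z} → z L.< y → ¬ Bounds z
        minimal = proj₂ (proj₂ bound)
        -- If no element below `x` matched `y′`, no match could equal `y′`, nor exceed it (`back`
        -- would reach `y′`). Then `y′` would be a smaller bound.
        reached : ∀ {y′} → y′ L.< y → ∃ λ x′ → Matches K L x′ y′ × x′ K.< x
        reached {y′} y′<y = decidable-stable em λ unreached →
          minimal y′<y λ {x′} x′<x → below unreached x′<x
          where
          below : ¬ (∃ λ x′ → Matches K L x′ y′ × x′ K.< x) →
                  ∀ {x′} → x′ K.< x → ∃ λ y″ → Matches K L x′ y″ × y″ L.< y′
          below unreached {x′} x′<x with y″ , m@(matches _ back) , _ ← above x′<x
            with L.compare y″ y′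
          ... | tri< y″<y′ _ _ = y″ , m , y″<y′
          ... | tri≈ _ y″≈y′ _ = ⊥-elim (unreached (x′ , Matches-respʳ y″≈y′ m , x′<x))
          ... | tri> _ _ y′<y″ = let x₁ , m₁ , x₁<x′ = back y′<y″ in
                                 ⊥-elim (unreached (x₁ , m₁ , K.trans x₁<x′ x′<x))

  module _ {K L : LinearOrder} where
    private
      module K = StrictTotalOrder K
      module L = StrictTotalOrder L

    -- The embedding `f` gives every element of `K` a match and `g` every element of `L`, so the
    -- matching is the graph of an isomorphism.
    wellOrder-antisym :
      WellFounded K._<_ → WellFounded L._<_ →
      (f : K.Carrier → L.Carrier) → f Preserves K._<_ ⟶ L._<_ →
      (g : L.Carrier → K.Carrier) → g Preserves L._<_ ⟶ K._<_ →
      K.rawRelation ≅ L.rawRelation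
    wellOrder-antisym wfK wfL f f-mono g g-mono =
      increasing-surjection⇒≅ {K} {L} h
        (λ {x} {x′} x≈x′ → Matches-functional {K} {L} (Matches-respˡ x≈x′ (h-matches x)) (h-matches x′))
        (λ {x} {x′} → Matches-mono {K} {L} (h-matches x) (h-matches x′))
        λ y → let x , m = Matches-total {L} {K} wfL wfK g g-mono y in
              x , Matches-functional {K} {L} (h-matches x) (Matches-flip m)
      where
      h : K.Carrier → L.Carrier
      h x = proj₁ (Matches-total {K} {L} wfK wfL f f-mono x)
      h-matches : ∀ x → Matches K L x (h x)
      h-matches x = proj₂ (Matches-total {K} {L} wfK wfL f f-mono x)

-- The hull construction

module _ (A : Structure) where
  open Structure A hiding (rawRelation)

  -- The weak inequalities of convexity are stated as negations because that is how basic sentences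
  -- express them.
  record InHull (z y : ℕ) : Set where
    constructor inHull
    field
      z∈Dom : z ∈ Dom
      y∈Dom : y ∈ Dom
      {x w} : ℕ
      x∈Dom : x ∈ Dom
      w∈Dom : w ∈ Dom
      x≤z   : x ≤ z
      w≤z   : w ≤ z
      y⊀x   : ¬ (y ≺ x)
      w⊀y   : ¬ (w ≺ y)

  hull : Structure
  hull = record
    { Dom = λ n → ∃ λ z → ∃ λ y → n ≡ pair z y × InHull z y
    ; _≺_ = λ m n → ∃ λ z → ∃ λ y → ∃ λ z′ → ∃ λ y′ →
              m ≡ pair z y × n ≡ pair z′ y′ × (z ≺ z′ ⊎ z ≡ z′ × y ≺ y′)
    }

IsLinear : Structure → Set
IsLinear A = IsStrictTotalOrder _≈_ _∼_
  where open RawRelation (rawRelation A)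

≅⇒isLinear : ∀ {A} (K : LinearOrder) → rawRelation A ≅ raw K → IsLinear A
≅⇒isLinear K (_ , F) = OrderMonomorphism.isStrictTotalOrder F.isOrderMonomorphism K.isStrictTotalOrder
  where
  module F = IsOrderIsomorphism F
  module K = StrictTotalOrder K

module Hull (A : Structure) (A-linear : IsLinear A) where
  open Structure A hiding (rawRelation)
  private module H = Structure (hull A)

  order : LinearOrder
  order = record { isStrictTotalOrder = A-linear }

  coordinates : ∃ H.Dom → ∃ Dom × ∃ Dom
  coordinates (_ , z , y , _ , h) = (z , InHull.z∈Dom h) , (y , InHull.y∈Dom h)

  -- Linearity of the hull is pulled back along this map from the lexicographic square of `A`.
  coordinates-isOrderMonomorphism :
    IsOrderMonomorphism (_≡_ on proj₁) (StrictTotalOrder._≈_ (order · order))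
                        (H._≺_ on proj₁) (StrictTotalOrder._<_ (order · order)) coordinates
  coordinates-isOrderMonomorphism = record
    { isOrderHomomorphism = record
      { cong = λ {m} {n} → ≈-cong {m} {n} ; mono = λ {m} {n} → mono {m} {n} }
    ; injective = λ {m} {n} → injective {m} {n}
    ; cancel    = λ {m} {n} → cancel {m} {n}
    }
    where
    ≈-cong : ∀ {m n} → proj₁ m ≡ proj₁ n →
             StrictTotalOrder._≈_ (order · order) (coordinates m) (coordinates n)
    ≈-cong {_ , z , y , m≡ , _} {_ , z′ , y′ , n≡ , _} m≡n =
      pair-injective z y z′ y′ (trans (sym m≡) (trans m≡n n≡))
    injective : ∀ {m n} → StrictTotalOrder._≈_ (order · order) (coordinates m) (coordinates n) →
                proj₁ m ≡ proj₁ n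
    injective {_ , _ , _ , m≡ , _} {_ , _ , _ , n≡ , _} (z≡z′ , y≡y′) =
      trans m≡ (trans (cong₂ pair z≡z′ y≡y′) (sym n≡))
    cancel : ∀ {m n} → StrictTotalOrder._<_ (order · order) (coordinates m) (coordinates n) →
             proj₁ m H.≺ proj₁ n
    cancel {_ , _ , _ , m≡ , _} {_ , _ , _ , n≡ , _} lt = _ , _ , _ , _ , m≡ , n≡ , lt
    mono : ∀ {m n} → proj₁ m H.≺ proj₁ n →
           StrictTotalOrder._<_ (order · order) (coordinates m) (coordinates n)
    mono {_ , z , y , m≡ , _} {_ , z′ , y′ , n≡ , _} (z₁ , y₁ , z₁′ , y₁′ , m≡₁ , n≡₁ , lt)
      with refl , refl ← pair-injective z y z₁ y₁ (trans (sym m≡) m≡₁)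
         | refl , refl ← pair-injective z′ y′ z₁′ y₁′ (trans (sym n≡) n≡₁) = lt

  hull-isLinear : IsLinear (hull A)
  hull-isLinear = OrderMonomorphism.isStrictTotalOrder coordinates-isOrderMonomorphism
                    (StrictTotalOrder.isStrictTotalOrder (order · order))

  private module L = IsStrictTotalOrder hull-isLinear

  axiom-sound : ∀ {α φ} → Axiom α φ → All (_∈ diagram) α → φ ∈ H.diagram
  axiom-sound (self {z} {y} x≤z w≤z r)
    (((dz , _) , _) ∷ ((dy , dx) , y⊀x) ∷ ((dw , _) , w⊀y) ∷ []) = reflexive r
    where
    du : pair z y ∈ H.Dom
    du = z , y , refl , inHull dz dy dx dw x≤z w≤z y⊀x w⊀y
    reflexive : ∀ {φ} → Reflexive (pair z y) φ → φ ∈ H.diagram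
    reflexive pos≈ = (du , du) , refl
    reflexive neg< = (du , du) , L.irrefl {_ , du} {_ , du} refl
  axiom-sound (less {z} {y} {x} {w} {z′} {y′} x≤z w≤z x′≤z′ w′≤z′ p s)
    (ψ ∷ ((dz , _) , _) ∷ ((dy , dx) , y⊀x) ∷ ((dw , _) , w⊀y)
       ∷ ((dz′ , _) , _) ∷ ((dy′ , dx′) , y′⊀x′) ∷ ((dw′ , _) , w′⊀y′) ∷ []) = strict s
    where
    du : pair z y ∈ H.Dom
    du = z , y , refl , inHull dz dy dx dw x≤z w≤z y⊀x w⊀y
    dv : pair z′ y′ ∈ H.Dom
    dv = z′ , y′ , refl , inHull dz′ dy′ dx′ dw′ x′≤z′ w′≤z′ y′⊀x′ w′⊀y′
    premise : ∀ {ψ} → Premise z y z′ y′ ψ → ψ ∈ diagram → z ≺ z′ ⊎ z ≡ z′ × y ≺ y′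
    premise first         (_ , z≺z′) = inj₁ z≺z′
    premise (second z≡z′) (_ , y≺y′) = inj₂ (z≡z′ , y≺y′)
    u≺v : pair z y H.≺ pair z′ y′
    u≺v = z , y , z′ , y′ , refl , refl , premise p ψ
    strict : ∀ {φ} → Strict (pair z y) (pair z′ y′) φ → φ ∈ H.diagram
    strict pos<  = (du , dv) , u≺v
    strict neg>  = (dv , du) , λ v≺u → L.asym {_ , du} {_ , dv} u≺v v≺u
    strict neg≈  = (du , dv) , λ u≡v → L.irrefl {_ , du} {_ , dv} u≡v u≺v
    strict neg≈˘ = (dv , du) , λ v≡u → L.irrefl {_ , du} {_ , dv} (sym v≡u) u≺v

  Derives : Pred Basic 0ℓ
  Derives = EnumerationOperator.⟦_⟧ hullOperator diagram

  derive-reflexive : ∀ {u φ} → u ∈ H.Dom → Reflexive u φ → Derives φ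
  derive-reflexive (z , y , refl , inHull dz dy dx dw x≤z w≤z y⊀x w⊀y) r =
    _ , self x≤z w≤z r , ((dz , dz) , refl) ∷ ((dy , dx) , y⊀x) ∷ ((dw , dy) , w⊀y) ∷ []

  derive-strict : ∀ {u v φ} → u ∈ H.Dom → v ∈ H.Dom → u H.≺ v → Strict u v φ → Derives φ
  derive-strict du@(z , y , refl , h) dv@(z′ , y′ , refl , h′) u≺v s =
    -- The relation `u≺v` carries its own decoding of `u` and `v`; injectivity of pairing, through
    -- `mono`, identifies it with the given coordinates.
    conclude (IsOrderMonomorphism.mono coordinates-isOrderMonomorphism {_ , du} {_ , dv} u≺v)
    where
    open InHull h
    open InHull h′ renaming
      ( z∈Dom to z∈Dom′; y∈Dom to y∈Dom′; x∈Dom to x∈Dom′; w∈Dom to w∈Dom′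
      ; x≤z to x≤z′; w≤z to w≤z′; y⊀x to y⊀x′; w⊀y to w⊀y′; x to x′; w to w′)
    derive : ∀ {ψ} → Premise z y z′ y′ ψ → ψ ∈ diagram → Derives _
    derive p d =
      _ , less x≤z w≤z x≤z′ w≤z′ p s ,
      d ∷ ((z∈Dom , z∈Dom) , refl) ∷ ((y∈Dom , x∈Dom) , y⊀x) ∷ ((w∈Dom , y∈Dom) , w⊀y)
        ∷ ((z∈Dom′ , z∈Dom′) , refl) ∷ ((y∈Dom′ , x∈Dom′) , y⊀x′) ∷ ((w∈Dom′ , y∈Dom′) , w⊀y′) ∷ []
    conclude : z ≺ z′ ⊎ z ≡ z′ × y ≺ y′ → Derives _
    conclude (inj₁ z≺z′)          = derive first ((z∈Dom , z∈Dom′) , z≺z′)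
    conclude (inj₂ (z≡z′ , y≺y′)) = derive (second z≡z′) ((y∈Dom , y∈Dom′) , y≺y′)

  -- For a negative sentence, trichotomy in the hull supplies the strict inequality or the equality
  -- that implies it, and the axiom for that fact applies.
  axiom-complete : ∀ {φ} → φ ∈ H.diagram → Derives φ
  axiom-complete {pos (u ≈ᶜ _)} ((du , _) , refl) = derive-reflexive du pos≈
  axiom-complete {pos (u <ᶜ v)} ((du , dv) , u≺v) = derive-strict du dv u≺v pos<
  axiom-complete {neg (u ≈ᶜ v)} ((du , dv) , u≢v) with L.compare (u , du) (v , dv)
  ... | tri< u≺v _ _ = derive-strict du dv u≺v neg≈
  ... | tri≈ _ u≡v _ = ⊥-elim (u≢v u≡v)
  ... | tri> _ _ v≺u = derive-strict dv du v≺u neg≈˘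
  axiom-complete {neg (u <ᶜ v)} ((du , dv) , u⊀v) with L.compare (u , du) (v , dv)
  ... | tri< u≺v _ _  = ⊥-elim (u⊀v u≺v)
  ... | tri≈ _ refl _ = derive-reflexive du neg<
  ... | tri> _ _ v≺u  = derive-strict dv du v≺u neg>

  hull-maps : Maps hullOperator A (hull A)
  hull-maps = (λ (_ , ax , α⊆) → axiom-sound ax α⊆) , axiom-complete

-- The hull of a copy of ω² has order type ω³

ω²-wellFounded : WellFounded (StrictTotalOrder._<_ ω²)
ω²-wellFounded = ×-wellFounded <-wellFounded <-wellFounded

ω³-wellFounded : WellFounded (StrictTotalOrder._<_ ω³)
ω³-wellFounded = ×-wellFounded <-wellFounded ω²-wellFounded

module HullOfω² (em : ExcludedMiddle 0ℓ) (A : Structure)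
                (A≅ω² : rawRelation A ≅ raw ω²) where
  open Structure A hiding (rawRelation)
  open Hull A (≅⇒isLinear {A} ω² A≅ω²)
  open Classical em
  private
    module H  = Structure (hull A)
    module F  = IsOrderIsomorphism (proj₂ A≅ω²)
    module ω² = StrictTotalOrder ω²
    module ω³ = StrictTotalOrder ω³

  f : ∃ Dom → ℕ × ℕ
  f = proj₁ A≅ω²

  ω²≅A : raw ω² ≅ rawRelation A
  ω²≅A = ≅-sym (rawRelation A) ω² refl A≅ω²

  g : ℕ × ℕ → ∃ Dom
  g = proj₁ ω²≅A

  module G = IsOrderIsomorphism (proj₂ ω²≅A)

  fg≈ : ∀ s → f (g s) ω².≈ s
  fg≈ s = proj₂ (F.surjective s) refl

  label : ∃ Dom → ℕ
  label = proj₁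

  -- Only finitely many elements have small labels; excluded middle decides at each step whether `N`
  -- is one. Compatibility of `r` makes the choice of membership proof immaterial.
  bounded-on-small-labels : (r : ∃ Dom → ℕ) → (∀ {a b} → label a ≡ label b → r a ≡ r b) →
                            ∀ N → ∃ λ b → ∀ a → label a < N → r a < b
  bounded-on-small-labels r r-cong zero = 0 , λ _ ()
  bounded-on-small-labels r r-cong (suc N)
    with b , below ← bounded-on-small-labels r r-cong N
       | em {P = Dom N}
  ... | no N∉Dom = b , λ { a@(_ , n∈Dom) (s≤s n≤N) → below a (≤∧≢⇒< n≤N λ { refl → N∉Dom n∈Dom }) }
  ... | yes N∈Dom = b ⊔ suc (r (N , N∈Dom)) , λ { a (s≤s n≤N) → bound a (m≤n⇒m<n∨m≡n n≤N) }
    where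
    bound : ∀ a → label a < N ⊎ label a ≡ N → r a < b ⊔ suc (r (N , N∈Dom))
    bound a (inj₁ n<N) = ≤-trans (below a n<N) (m≤m⊔n b _)
    bound a (inj₂ n≡N) = ≤-trans (s≤s (≤-reflexive (r-cong n≡N))) (m≤n⊔m b _)

  block offset : ∃ Dom → ℕ
  block  = proj₁ ∘ f
  offset = proj₂ ∘ f

  blockBound : ℕ → ℕ
  blockBound N = proj₁ (bounded-on-small-labels block (proj₁ ∘ F.cong) (suc N))

  block<blockBound : ∀ a {N} → label a ≤ N → block a < blockBound N
  block<blockBound a {N} a≤N =
    proj₂ (bounded-on-small-labels block (proj₁ ∘ F.cong) (suc N)) a (s≤s a≤N)

  width : ℕ → ℕ → ℕ
  width m i = blockBound (label (g (m , i)))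

  -- In `A`, `y` is at most `w`, and `w` is among the finitely many elements with label at most `z`.
  hull-width : ∀ {z y} (h : InHull A z y) →
               let m , i = f (z , InHull.z∈Dom h) in block (y , InHull.y∈Dom h) < width m i
  hull-width {z} {y} (inHull z∈Dom y∈Dom {x} {w} _ w∈Dom _ w≤z _ w⊀y) =
    ≤-<-trans block-y≤block-w
      (subst (λ n → block (w , w∈Dom) < blockBound n) z≡ (block<blockBound (w , w∈Dom) w≤z))
    where
    z≡ : z ≡ label (g (f (z , z∈Dom)))
    z≡ = F.injective {z , z∈Dom} {g (f (z , z∈Dom))} (ω².Eq.sym (fg≈ (f (z , z∈Dom))))
    block-y≤block-w : block (y , y∈Dom) ≤ block (w , w∈Dom)
    block-y≤block-w = ≮⇒≥ λ lt → w⊀y (F.cancel {w , w∈Dom} {y , y∈Dom} (inj₁ lt))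

  origin : ℕ → ℕ → ℕ
  origin m zero    = 0
  origin m (suc i) = origin m i + width m i

  origin-mono : ∀ m {i i′} → i ≤ i′ → origin m i ≤ origin m i′
  origin-mono m {i′ = zero}  z≤n = z≤n
  origin-mono m {i′ = suc i′} i≤ with m≤n⇒m<n∨m≡n i≤
  ... | inj₁ (s≤s i≤i′) = ≤-trans (origin-mono m i≤i′) (m≤m+n _ _)
  ... | inj₂ refl       = ≤-refl

  -- The fibres over the i-th element of block m are laid end to end in ω², the i-th
  -- one starting at ω · origin m i.
  stack : (ℕ × ℕ) × (ℕ × ℕ) → ℕ × (ℕ × ℕ)
  stack ((m , i) , (p , q)) = m , (origin m i + p , q)

  -- The hypothesis on `p` keeps the `i`-th fibre below the origin of the next one; inside a single
  -- fibre the common origin cancels.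
  stack-mono : ∀ {m i p q t} → p < width m i →
               StrictTotalOrder._<_ (ω² · ω²) ((m , i) , (p , q)) t →
               stack ((m , i) , (p , q)) ω³.< stack t
  stack-mono p< (inj₁ (inj₁ m<m′)) = inj₁ m<m′
  stack-mono {m} {i} {p} {q} {(_ , i′) , (p′ , _)} p< (inj₁ (inj₂ (refl , i<i′))) =
    inj₂ (refl , inj₁ (begin-strict
    origin m i + p         <⟨ +-monoʳ-< (origin m i) p< ⟩
    origin m (suc i)       ≤⟨ origin-mono m i<i′ ⟩
    origin m i′            ≤⟨ m≤m+n (origin m i′) p′ ⟩
    origin m i′ + p′       ∎))
    where open ≤-Reasoning
  stack-mono {m} {i} p< (inj₂ ((refl , refl) , inj₁ p<p′)) = inj₂ (refl , inj₁ (+-monoʳ-< (origin m i) p<p′))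
  stack-mono p< (inj₂ ((refl , refl) , inj₂ (refl , q<q′))) = inj₂ (refl , inj₂ (refl , q<q′))

  up : ∃ H.Dom → ℕ × (ℕ × ℕ)
  up u = let z , y = coordinates u in stack (f z , f y)

  up-mono : ∀ {u v} → proj₁ u H.≺ proj₁ v → up u ω³.< up v
  up-mono {u@(_ , _ , _ , _ , h)} {v} u≺v =
    stack-mono (hull-width h) (f×f (IsOrderMonomorphism.mono coordinates-isOrderMonomorphism {u} {v} u≺v))
    where
    f×f : ∀ {z y z′ y′} → StrictTotalOrder._<_ (order · order) (z , y) (z′ , y′) →
          StrictTotalOrder._<_ (ω² · ω²) (f z , f y) (f z′ , f y′)
    f×f (inj₁ z≺z′)          = inj₁ (F.mono z≺z′)
    f×f (inj₂ (z≡z′ , y≺y′)) = inj₂ (F.cong z≡z′ , F.mono y≺y′)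

  -- Only finitely many labels lie below that of the least element, so one `T` serves all blocks at
  -- once.
  threshold : ∃ λ T → ∀ a → label a < label (g (0 , 0)) → offset a < T
  threshold = bounded-on-small-labels offset (proj₂ ∘ F.cong) (label (g (0 , 0)))

  -- Past the threshold the labels exceed that of the least element of A, so the fibre
  -- contains the first block.
  base : ℕ → ℕ → ∃ Dom
  base k i = g (suc k , proj₁ threshold + i)

  base-label : ∀ k i → label (g (0 , 0)) ≤ label (base k i)
  base-label k i = ≮⇒≥ λ lt → <⇒≱ (proj₂ threshold (base k i) lt)
    (≤-trans (m≤m+n _ i) (≤-reflexive (sym (proj₂ (fg≈ _)))))

  -- The hull is witnessed by the least element from below and by `base k i` itself from above; the
  -- latter lies in block `suc k`, hence beyond all of block 0.
  down : ℕ × (ℕ × ℕ) → ∃ H.Dom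
  down (k , (i , j)) = _ , label (base k i) , label (g (0 , j)) , refl , record
    { z∈Dom = proj₂ (base k i)
    ; y∈Dom = proj₂ (g (0 , j))
    ; x∈Dom = proj₂ (g (0 , 0))
    ; w∈Dom = proj₂ (base k i)
    ; x≤z   = base-label k i
    ; w≤z   = ≤-refl
    ; y⊀x   = λ y≺x → ≮0 (G.cancel {0 , j} {0 , 0} y≺x)
    ; w⊀y   = λ w≺y → later≮earlier (G.cancel {suc k , proj₁ threshold + i} {0 , j} w≺y)
    }
    where
    ≮0 : ¬ (0 , j) ω².< (0 , 0)
    ≮0 (inj₂ (_ , ()))
    later≮earlier : ∀ {k i j} → ¬ (suc k , i) ω².< (0 , j)
    later≮earlier (inj₁ ())

  down-mono : ∀ {s t} → s ω³.< t → proj₁ (down s) H.≺ proj₁ (down t)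
  down-mono {k , (i , j)} {k′ , (i′ , j′)} s<t =
    label (base k i) , label (g (0 , j)) , label (base k′ i′) , label (g (0 , j′)) , refl , refl , lex s<t
    where
    lex : (k , (i , j)) ω³.< (k′ , (i′ , j′)) →
          label (base k i) ≺ label (base k′ i′) ⊎
          label (base k i) ≡ label (base k′ i′) × label (g (0 , j)) ≺ label (g (0 , j′))
    lex (inj₁ k<k′)                           = inj₁ (G.mono (inj₁ (s≤s k<k′)))
    lex (inj₂ (refl , inj₁ i<i′))             = inj₁ (G.mono (inj₂ (refl , +-monoʳ-< (proj₁ threshold) i<i′)))
    lex (inj₂ (refl , inj₂ (refl , j<j′)))    = inj₂ (refl , G.mono (inj₂ (refl , j<j′)))

  -- The hull inherits well-foundedness from ω³ through `up`, after which `up` and `down` are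
  -- embeddings of well-orders in both directions.
  hull≅ω³ : rawRelation (hull A) ≅ ω³.rawRelation
  hull≅ω³ = wellOrder-antisym {record { isStrictTotalOrder = hull-isLinear }} {ω³}
    (Subrelation.wellFounded (λ {u} {v} → up-mono {u} {v}) (On.wellFounded up ω³-wellFounded))
    ω³-wellFounded
    up (λ {u} {v} → up-mono {u} {v}) down down-mono

-- Reversal

reverse : Structure → Structure
reverse A = record { Dom = Dom ; _≺_ = flip _≺_ }
  where open Structure A

≅-flip : ∀ {X Y : RawRelation 0ℓ 0ℓ 0ℓ} → X ≅ Y →
         record { _≈_ = RawRelation._≈_ X ; _∼_ = flip (RawRelation._∼_ X) } ≅
         record { _≈_ = RawRelation._≈_ Y ; _∼_ = flip (RawRelation._∼_ Y) }
≅-flip (f , F) = f , record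
  { isOrderMonomorphism = record
    { isOrderHomomorphism = record { cong = F.cong ; mono = F.mono }
    ; injective = F.injective
    ; cancel    = F.cancel
    }
  ; surjective = F.surjective
  }
  where module F = IsOrderIsomorphism F

-- The identity on numbers works: reversal exchanges the roles of `x` and `w` and inverts both
-- coordinates of the lexicographic order.
hull-reverse : ∀ A → rawRelation (hull A) ≅ rawRelation (reverse (hull (reverse A)))
hull-reverse A = map₂ reverse-hull , record
  { isOrderMonomorphism = record
    { isOrderHomomorphism = record
      { cong = id
      ; mono = λ { (z , y , z′ , y′ , m≡ , n≡ , m≺n) → z′ , y′ , z , y , n≡ , m≡ , swap m≺n }
      }
    ; injective = id
    ; cancel    = λ { (z , y , z′ , y′ , m≡ , n≡ , m≺n) → z′ , y′ , z , y , n≡ , m≡ , swap m≺n }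
    }
  ; surjective = λ (n , z , y , n≡ , h) → (n , z , y , n≡ , reverse-inHull h) , id
  }
  where
  open Structure A
  reverse-inHull : ∀ {B z y} → InHull B z y → InHull (reverse B) z y
  reverse-inHull (inHull dz dy dx dw x≤z w≤z y⊀x w⊀y) = inHull dz dy dw dx w≤z x≤z w⊀y y⊀x
  reverse-hull : ∀ {n} → Structure.Dom (hull A) n → Structure.Dom (hull (reverse A)) n
  reverse-hull (z , y , n≡ , h) = z , y , n≡ , reverse-inHull h
  swap : ∀ {P Q : Set} {z z′ : ℕ} → P ⊎ z ≡ z′ × Q → P ⊎ z′ ≡ z × Q
  swap (inj₁ p)        = inj₁ p
  swap (inj₂ (eq , q)) = inj₂ (sym eq , q)

-- Order types of the images and verification of the embedding

-- The identity on numbers works, since the domain is recovered from the sentences `pos (n ≈ᶜ n)`.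
diagram-≐⇒≅ : ∀ {A B} → Structure.diagram A ≐ Structure.diagram B → rawRelation A ≅ rawRelation B
diagram-≐⇒≅ {A} {B} (A⊆B , B⊆A) = map₂ A⇒B , record
  { isOrderMonomorphism = record
    { isOrderHomomorphism = record
      { cong = id
      ; mono = λ { {m , dm} {n , dn} m≺n → proj₂ (A⊆B {pos (m <ᶜ n)} ((dm , dn) , m≺n)) }
      }
    ; injective = id
    ; cancel    = λ { {m , dm} {n , dn} m≺n → proj₂ (B⊆A {pos (m <ᶜ n)} ((A⇒B dm , A⇒B dn) , m≺n)) }
    }
  ; surjective = λ (n , dn) → (n , proj₁ (proj₁ (B⊆A {pos (n ≈ᶜ n)} ((dn , dn) , refl)))) , id
  }
  where
  A⇒B : ∀ {n} → Structure.Dom A n → Structure.Dom B n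
  A⇒B {n} dn = proj₁ (proj₁ (A⊆B {pos (n ≈ᶜ n)} ((dn , dn) , refl)))

module _ (K : LinearOrder) where
  private module K = StrictTotalOrder K

  -- The values `f (s n)` would form an infinite descending sequence.
  no-antitone-map : WellFounded K._<_ → (s : ℕ → K.Carrier) → (∀ n → s n K.< s (suc n)) →
                    (f : K.Carrier → K.Carrier) → (∀ {x y} → x K.< y → f y K.< f x) → ⊥
  no-antitone-map wf s s-increasing f antitone = descend (wf (f (s 0))) 0 refl
    where
    descend : ∀ {x} → Acc K._<_ x → ∀ n → x ≡ f (s n) → ⊥
    descend (acc rs) n refl = descend (rs (antitone (s-increasing n))) (suc n) refl

  ≅-through : ∀ {A B} → rawRelation A ≅ raw K → rawRelation B ≅ raw K → rawRelation A ≅ rawRelation B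
  ≅-through {A} {B} A≅K B≅K = ≅-trans trans A≅K (≅-sym (rawRelation B) K refl B≅K)

  module _ (wf : WellFounded K._<_)
           (s : ℕ → K.Carrier) (s-increasing : ∀ n → s n K.< s (suc n)) where

    -- Composing the three isomorphisms would give an order-reversing map of `K` to itself.
    ≇⋆ : ∀ {A B} → rawRelation A ≅ raw K → rawRelation B ≅ raw (K ⋆) → ¬ (rawRelation A ≅ rawRelation B)
    ≇⋆ {A} {B} A≅K B≅K⋆ A≅B = no-antitone-map wf s s-increasing f F.mono
      where
      K≅K⋆ : raw K ≅ raw (K ⋆)
      K≅K⋆ = ≅-trans K.Eq.trans (≅-sym (rawRelation A) K refl A≅K) (≅-trans K.Eq.trans A≅B B≅K⋆)
      f = proj₁ K≅K⋆
      module F = IsOrderIsomorphism (proj₂ K≅K⋆)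

    ⋆≇ : ∀ {A B} → rawRelation A ≅ raw (K ⋆) → rawRelation B ≅ raw K → ¬ (rawRelation A ≅ rawRelation B)
    ⋆≇ {A} {B} A≅K⋆ B≅K A≅B = no-antitone-map wf s s-increasing f F.mono
      where
      K⋆≅K : raw (K ⋆) ≅ raw K
      K⋆≅K = ≅-trans K.Eq.trans (≅-sym (rawRelation A) (K ⋆) refl A≅K⋆) (≅-trans K.Eq.trans A≅B B≅K)
      f = proj₁ K⋆≅K
      module F = IsOrderIsomorphism (proj₂ K⋆≅K)

module _ (em : ExcludedMiddle 0ℓ) where

  -- The reverse of `A` is a copy of ω², and `hull-reverse` turns the result for its hull around.
  hull≅ω³⋆ : ∀ {A} → rawRelation A ≅ raw (ω² ⋆) → rawRelation (hull A) ≅ raw (ω³ ⋆)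
  hull≅ω³⋆ {A} A≅ω²⋆ =
    ≅-trans (StrictTotalOrder.Eq.trans ω³) (hull-reverse A)
      (≅-flip (HullOfω².hull≅ω³ em (reverse A) (≅-flip A≅ω²⋆)))

  linear : ∀ {A} → A ∈ ⟪ ω² , ω² ⋆ ⟫ₗ → IsLinear A
  linear {A} (inj₁ A≅ω²)  = ≅⇒isLinear {A} ω² A≅ω²
  linear {A} (inj₂ A≅ω²⋆) = ≅⇒isLinear {A} (ω² ⋆) A≅ω²⋆

  -- The definition of embedding speaks of every `B` with the right diagram; this reduces each of
  -- them to the hull.
  image≅hull : ∀ {A B} → A ∈ ⟪ ω² , ω² ⋆ ⟫ₗ → Maps hullOperator A B →
               rawRelation B ≅ rawRelation (hull A)
  image≅hull {A} {B} A∈K₀ A↦B =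
    diagram-≐⇒≅ {B} {hull A} (≐-trans (≐-sym A↦B) (Hull.hull-maps A (linear {A} A∈K₀)))

  image≅ω³ : ∀ {A B} → rawRelation A ≅ raw ω² → Maps hullOperator A B → rawRelation B ≅ raw ω³
  image≅ω³ {A} {B} A≅ω² A↦B =
    ≅-trans (StrictTotalOrder.Eq.trans ω³) (image≅hull {A} {B} (inj₁ A≅ω²) A↦B)
      (HullOfω².hull≅ω³ em A A≅ω²)

  image≅ω³⋆ : ∀ {A B} → rawRelation A ≅ raw (ω² ⋆) → Maps hullOperator A B → rawRelation B ≅ raw (ω³ ⋆)
  image≅ω³⋆ {A} {B} A≅ω²⋆ A↦B =
    ≅-trans (StrictTotalOrder.Eq.trans ω³) (image≅hull {A} {B} (inj₂ A≅ω²⋆) A↦B)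
      (hull≅ω³⋆ {A} A≅ω²⋆)

  -- When the order types agree both sides hold; when they are opposite both are refuted by the
  -- absence of an order-reversing self-map.
  ≅⇔image≅ : ∀ {A A′ B B′} → A ∈ ⟪ ω² , ω² ⋆ ⟫ₗ → A′ ∈ ⟪ ω² , ω² ⋆ ⟫ₗ →
             Maps hullOperator A B → Maps hullOperator A′ B′ →
             rawRelation A ≅ rawRelation A′ ⇔ rawRelation B ≅ rawRelation B′
  ≅⇔image≅ {A} {A′} {B} {B′} (inj₁ a) (inj₁ a′) m m′ = mk⇔
    (const (≅-through ω³ {B} {B′} (image≅ω³ {A} {B} a m) (image≅ω³ {A′} {B′} a′ m′)))
    (const (≅-through ω² {A} {A′} a a′))
  ≅⇔image≅ {A} {A′} {B} {B′} (inj₂ a) (inj₂ a′) m m′ = mk⇔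
    (const (≅-through (ω³ ⋆) {B} {B′} (image≅ω³⋆ {A} {B} a m) (image≅ω³⋆ {A′} {B′} a′ m′)))
    (const (≅-through (ω² ⋆) {A} {A′} a a′))
  ≅⇔image≅ {A} {A′} {B} {B′} (inj₁ a) (inj₂ a′) m m′ = mk⇔
    (⊥-elim ∘ ≇⋆ ω² ω²-wellFounded (λ n → 0 , n) (λ n → inj₂ (refl , n<1+n n)) {A} {A′} a a′)
    (⊥-elim ∘ ≇⋆ ω³ ω³-wellFounded (λ n → 0 , 0 , n) (λ n → inj₂ (refl , inj₂ (refl , n<1+n n)))
      {B} {B′} (image≅ω³ {A} {B} a m) (image≅ω³⋆ {A′} {B′} a′ m′))
  ≅⇔image≅ {A} {A′} {B} {B′} (inj₂ a) (inj₁ a′) m m′ = mk⇔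
    (⊥-elim ∘ ⋆≇ ω² ω²-wellFounded (λ n → 0 , n) (λ n → inj₂ (refl , n<1+n n)) {A} {A′} a a′)
    (⊥-elim ∘ ⋆≇ ω³ ω³-wellFounded (λ n → 0 , 0 , n) (λ n → inj₂ (refl , inj₂ (refl , n<1+n n)))
      {B} {B′} (image≅ω³⋆ {A} {B} a m) (image≅ω³ {A′} {B′} a′ m′))

theorem6p2 : ExcludedMiddle 0ℓ → ⟪ ω² , ω² ⋆ ⟫ₗ ≤c ⟪ ω³ , ω³ ⋆ ⟫ₗ
theorem6p2 em = hullOperator , record
  { maps = λ {A} A∈K₀ → hull A , hull∈ {A} A∈K₀ , Hull.hull-maps A (linear em {A} A∈K₀)
  ; preservesReflects≅ = λ {A} {A′} {B} {B′} → ≅⇔image≅ em {A} {A′} {B} {B′}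
  }
  where
  hull∈ : ∀ {A} → A ∈ ⟪ ω² , ω² ⋆ ⟫ₗ → hull A ∈ ⟪ ω³ , ω³ ⋆ ⟫ₗ
  hull∈ {A} (inj₁ A≅ω²)  = inj₁ (HullOfω².hull≅ω³ em A A≅ω²)
  hull∈ {A} (inj₂ A≅ω²⋆) = inj₂ (hull≅ω³⋆ em {A} A≅ω²⋆)
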